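{- For every integer $n\geq 0$, \[ \overline{p}(n)\equiv (-1)^{n}\,\overline{p}(4n)\pmod{8}. \]
   Context: An overpartition of a nonnegative integer $n$ is a partition of $n$ in which the first occurrence of each distinct part may be overlined. $\overline{p}(n)$ denotes the number of overpartitions of $n$, with $\overline{p}(0)=1$; equivalently $\sum_{n\ge0}\overline{p}(n)q^n=\prod_{k\ge1}\frac{1+q^k}{1-q^k}$. -}

module Defs where

open import Data.Bool using (Bool; true; false)
import Data.Bool.Properties as Bool
open import Data.Integer using (ℤ; +_; _-_)
open import Data.Integer.Divisibility using (_∣_)
open import Data.List using (List; []; _∷_; length; map; filter; upTo; cartesianProductWith)
open import Data.List.Membership.Propositional using (_∈_)
open import Data.List.Membership.Propositional.Properties
  using (∈-filter⁺; ∈-filter⁻; ∈-upTo⁺; ∈-cartesianProductWith⁺; ∈-cartesianProductWith⁻)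
open import Data.List.Relation.Unary.All as All using (All; []; _∷_)
open import Data.List.Relation.Unary.AllPairs using ([]; _∷_)
open import Data.List.Relation.Unary.Any using (here; there)
open import Data.List.Relation.Unary.Linked using (Linked; linked?)
open import Data.List.Relation.Unary.Unique.Propositional using (Unique)
open import Data.List.Relation.Unary.Unique.Propositional.Properties
  using (cartesianProductWith⁺; filter⁺; upTo⁺)
open import Data.Nat using (ℕ; zero; suc; _+_; _≤_; _<_; _>_; z≤n; s≤s; _≟_; _<?_)
open import Data.Nat.ListAction using (sum)
open import Data.Nat.Properties using (+-mono-≤; ≤-refl; ≤-trans; m≤m+n; m≤n+m)
open import Data.Product using (_×_; _,_; proj₁; proj₂)
open import Data.Sum using (_⊎_)
open import Function using (_⇔_; mk⇔)
open import Relation.Binary.PropositionalEquality using (_≡_; _≢_; refl)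
open import Relation.Nullary using (Dec)
open import Relation.Nullary.Decidable using (map′; _×-dec_; _⊎-dec_)

_≡_[mod_] : ℤ → ℤ → ℕ → Set
a ≡ b [mod m ] = + m ∣ a - b

infix 4 _≡_[mod_]

record Part : Set where
  constructor part
  field
    size      : ℕ
    overlined : Bool

open Part public

-- Parts are listed in weakly decreasing order of size.  A part that has the
-- same size as its predecessor is not a first occurrence, hence not overlined.
_CanPrecede_ : Part → Part → Set
p CanPrecede q = size p > size q ⊎ (size p ≡ size q × overlined q ≡ false)

record _IsOverpartitionOf_ (π : List Part) (n : ℕ) : Set where
  constructor isOverpartition
  field
    positive : All (λ p → 0 < size p) π
    ordered  : Linked _CanPrecede_ π
    total    : sum (map size π) ≡ n

canPrecede? : ∀ p q → Dec (p CanPrecede q)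
canPrecede? p q =
  (size q <? size p) ⊎-dec ((size p ≟ size q) ×-dec (overlined q Bool.≟ false))

isOverpartitionOf? : ∀ n π → Dec (π IsOverpartitionOf n)
isOverpartitionOf? n π =
  map′ (λ (p , o , t) → isOverpartition p o t)
       (λ (isOverpartition p o t) → p , o , t)
       (All.all? (λ p → 0 <? size p) π
         ×-dec linked? canPrecede? π
         ×-dec (sum (map size π) ≟ n))

partsUpTo : ℕ → List Part
partsUpTo n = cartesianProductWith part (upTo (suc n)) (true ∷ false ∷ [])

listsUpTo : {A : Set} → List A → ℕ → List (List A)
listsUpTo xs zero    = [] ∷ []
listsUpTo xs (suc ℓ) = [] ∷ cartesianProductWith _∷_ xs (listsUpTo xs ℓ)

-- An overpartition of n has at most n parts, each of size at most n, so this
-- search is exhaustive: see ∈-overpartitions and overpartitions-unique below.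
overpartitions : ℕ → List (List Part)
overpartitions n = filter (isOverpartitionOf? n) (listsUpTo (partsUpTo n) n)

p̄ : ℕ → ℕ
p̄ n = length (overpartitions n)

partsUpTo-unique : ∀ n → Unique (partsUpTo n)
partsUpTo-unique n =
  cartesianProductWith⁺ part (λ { refl → refl , refl })
    (upTo⁺ (suc n)) (((λ ()) ∷ []) ∷ [] ∷ [])

∈-bools : ∀ b → b ∈ true ∷ false ∷ []
∈-bools true  = here refl
∈-bools false = there (here refl)

∈-partsUpTo : ∀ {n p} → size p ≤ n → p ∈ partsUpTo n
∈-partsUpTo {p = part s b} s≤n =
  ∈-cartesianProductWith⁺ part (∈-upTo⁺ (s≤s s≤n)) (∈-bools b)

listsUpTo-unique : ∀ {A : Set} {xs : List A} → Unique xs → ∀ ℓ → Unique (listsUpTo xs ℓ)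
listsUpTo-unique {xs = xs} u zero    = [] ∷ []
listsUpTo-unique {xs = xs} u (suc ℓ) =
  All.tabulate []≢ ∷
  cartesianProductWith⁺ _∷_ (λ { refl → refl , refl }) u (listsUpTo-unique u ℓ)
  where
  []≢ : ∀ {ys} → ys ∈ cartesianProductWith _∷_ xs (listsUpTo xs ℓ) → [] ≢ ys
  []≢ ys∈ refl with ∈-cartesianProductWith⁻ _∷_ xs (listsUpTo xs ℓ) ys∈
  ... | _ , _ , _ , _ , ()

∈-listsUpTo : ∀ {A : Set} {xs : List A} {ys ℓ} →
              All (_∈ xs) ys → length ys ≤ ℓ → ys ∈ listsUpTo xs ℓ
∈-listsUpTo {ℓ = zero}  []        _         = here refl
∈-listsUpTo {ℓ = suc ℓ} []        _         = here refl
∈-listsUpTo {ℓ = suc ℓ} (y ∷ ys∈) (s≤s len) =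
  there (∈-cartesianProductWith⁺ _∷_ y (∈-listsUpTo ys∈ len))

sizes≤sum : ∀ π → All (λ p → size p ≤ sum (map size π)) π
sizes≤sum []      = []
sizes≤sum (p ∷ π) =
  m≤m+n (size p) _ ∷
  All.map (λ s≤ → ≤-trans s≤ (m≤n+m (sum (map size π)) (size p))) (sizes≤sum π)

length≤sum : ∀ {π} → All (λ p → 0 < size p) π → length π ≤ sum (map size π)
length≤sum []         = z≤n
length≤sum (0<s ∷ 0<) = +-mono-≤ 0<s (length≤sum 0<)

overpartitions-unique : ∀ n → Unique (overpartitions n)
overpartitions-unique n =
  filter⁺ (isOverpartitionOf? n) (listsUpTo-unique (partsUpTo-unique n) n)

∈-overpartitions : ∀ n π → π ∈ overpartitions n ⇔ π IsOverpartitionOf n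
∈-overpartitions n π =
  mk⇔ (λ π∈ → proj₂ (∈-filter⁻ (isOverpartitionOf? n) {xs = listsUpTo (partsUpTo n) n} π∈))
      complete
  where
  complete : π IsOverpartitionOf n → π ∈ overpartitions n
  complete h@(isOverpartition pos _ refl) =
    ∈-filter⁺ (isOverpartitionOf? n)
      (∈-listsUpTo (All.map ∈-partsUpTo (sizes≤sum π)) (length≤sum pos)) h

module Submission where

-- Write P = ∑ p̄(n) qⁿ and Θ = ∑_{j ≥ 1} (−1)ʲ q^{j²}.  Gauss's identity (1 + 2Θ) P = 1 gives
-- P = 1 − 2Θ + 4Θ² − 8Θ³P.  A square is 0 or 1 mod 4, and the even squares are the numbers 4j², so
-- the coefficients of 1, Θ and Θ² at 4n are (−1)ⁿ times those at n; hence the congruence mod 8.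
-- Gauss's identity is the limit of ∑_{|j| ≤ n} (−1)ʲ q^{j²} (q²;q²)ₙ / ((q)ₙ₋ⱼ (q)ₙ₊ⱼ) = 1, whose
-- increments in n telescope; its quotients agree with ∏_{k ≤ n} (1 + qᵏ)/(1 − qᵏ) up to degree n − j.

open import Defs
open import Data.Nat using (ℕ)
import Data.Nat as ℕ
open import Data.Integer using (+_; -1ℤ; _*_; _^_)

open import Data.Bool using (Bool; true; false)
open import Data.Empty using (⊥; ⊥-elim)
open import Data.Integer using (ℤ; -[1+_]; 0ℤ; 1ℤ; _+_; _-_)
import Data.Integer.Properties as ℤ
open import Data.Integer.Divisibility.Signed using (divides; ∣⇒∣ᵤ)
open import Data.Integer.Tactic.RingSolver using (solve-∀)
open import Data.List using (List; []; _∷_; _++_; length; map; filter)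
open import Data.List.Membership.Propositional using (_∈_)
open import Data.List.Membership.Propositional.Properties
  using (∈-filter⁺; ∈-filter⁻; ∈-map⁺; ∈-map⁻; ∈-++⁺ˡ; ∈-++⁺ʳ; ∈-++⁻)
open import Data.List.Membership.Propositional.Properties.WithK using (unique∧set⇒bag)
open import Data.List.Properties using (length-++; length-map; ∷-injectiveʳ; filter-all)
open import Data.List.Relation.Binary.BagAndSetEquality using (∼bag⇒↭)
open import Data.List.Relation.Binary.Disjoint.Propositional using (Disjoint)
open import Data.List.Relation.Binary.Permutation.Propositional.Properties using (↭-length)
open import Data.List.Relation.Unary.All as All using (_∷_)
open import Data.List.Relation.Unary.AllPairs using ([])
open import Data.List.Relation.Unary.Any using (here)
open import Data.List.Relation.Unary.Linked as Linked using (Linked; []; [-]; _∷_)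
open import Data.List.Relation.Unary.Unique.Propositional using (Unique)
import Data.List.Relation.Unary.Unique.Propositional.Properties as Unique
open import Data.Nat using (zero; suc; _≤_; _<_; z≤n; s≤s; s≤s⁻¹; z<s; _≤?_; _∸_)
open import Data.Nat.ListAction using (sum)
import Data.Nat.Properties as ℕ
import Data.Nat.Tactic.RingSolver as ℕ
open import Data.Product using (_×_; _,_; ∃; proj₂)
open import Data.Sum using (_⊎_; inj₁; inj₂)
open import Data.Unit using (⊤; tt)
open import Function using (mk⇔; _∘_; Equivalence)
open import Relation.Binary.PropositionalEquality
  using (_≡_; _≗_; refl; sym; trans; cong; cong₂; subst; module ≡-Reasoning)
open import Relation.Nullary using (Dec; yes)

-- Shifted sequences

-- The default `d` is `[]` for families of lists and `0ℤ` for power series, so `shift-natural` with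
-- `+_ ∘ length` turns enumerations into generating functions.
shift : ∀ {A : Set} → A → ℕ → (ℕ → A) → ℕ → A
shift d zero    f n       = f n
shift d (suc k) f zero    = d
shift d (suc k) f (suc n) = shift d k f n

shift-natural : ∀ {A B : Set} (h : A → B) d k f n → h (shift d k f n) ≡ shift (h d) k (h ∘ f) n
shift-natural h d zero    f n       = refl
shift-natural h d (suc k) f zero    = refl
shift-natural h d (suc k) f (suc n) = shift-natural h d k f n

-- Agreement is asked only at the index that is read; this admits induction on the degree and
-- comparison of truncated series.
shift-cong : ∀ {A : Set} (d : A) k {f g : ℕ → A} n →
             (∀ i → k ℕ.+ i ≡ n → f i ≡ g i) → shift d k f n ≡ shift d k g n
shift-cong d zero    n       f≡g = f≡g n refl
shift-cong d (suc k) zero    f≡g = refl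
shift-cong d (suc k) (suc n) f≡g = shift-cong d k n (λ i e → f≡g i (cong suc e))

-- Counting overpartitions by their largest part

∈-shift⁺ : ∀ {A : Set} {x : A} k F i → x ∈ F i → x ∈ shift [] k F (k ℕ.+ i)
∈-shift⁺ zero    F i x∈ = x∈
∈-shift⁺ (suc k) F i x∈ = ∈-shift⁺ k F i x∈

∈-shift⁻ : ∀ {A : Set} {x : A} k F n → x ∈ shift [] k F n → ∃ λ i → k ℕ.+ i ≡ n × x ∈ F i
∈-shift⁻ zero    F n       x∈ = n , refl , x∈
∈-shift⁻ (suc k) F (suc n) x∈ with ∈-shift⁻ k F n x∈
... | i , refl , x∈F = i , refl , x∈F

shift-unique : ∀ {A : Set} k (F : ℕ → List A) n → (∀ i → Unique (F i)) → Unique (shift [] k F n)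
shift-unique zero    F n       u = u n
shift-unique (suc k) F zero    u = []
shift-unique (suc k) F (suc n) u = shift-unique k F n u

-- Duplicate-free lists with the same members are permutations of each other. This spares explicit
-- bijections in the two counting recurrences.
length-unique : ∀ {A : Set} {xs ys : List A} → Unique xs → Unique ys →
                (∀ {x} → x ∈ xs → x ∈ ys) → (∀ {x} → x ∈ ys → x ∈ xs) → length xs ≡ length ys
length-unique u v xs⊆ys ys⊆xs = ↭-length (∼bag⇒↭ (unique∧set⇒bag u v (mk⇔ xs⊆ys ys⊆xs)))

HeadAtMost : ℕ → List Part → Set
HeadAtMost k []      = ⊤
HeadAtMost k (p ∷ π) = size p ≤ k

-- The overlining of the preceding part is irrelevant to CanPrecede, so this says that some (any)
-- part of size k may stand in front.
CanFollow : ℕ → List Part → Set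
CanFollow k []      = ⊤
CanFollow k (p ∷ π) = part k true CanPrecede p

headAtMost? : ∀ k π → Dec (HeadAtMost k π)
headAtMost? k []      = yes tt
headAtMost? k (p ∷ π) = size p ≤? k

canFollow? : ∀ k π → Dec (CanFollow k π)
canFollow? k []      = yes tt
canFollow? k (p ∷ π) = canPrecede? (part k true) p

-- Sealing the two filters keeps the exhaustive search from unfolding; what follows uses membership,
-- uniqueness and `bounded-stable`.
opaque
  bounded : ℕ → ℕ → List (List Part)
  bounded k n = filter (headAtMost? k) (overpartitions n)

  following : ℕ → ℕ → List (List Part)
  following k n = filter (canFollow? k) (overpartitions n)

  bounded-unique : ∀ k n → Unique (bounded k n)
  bounded-unique k n = Unique.filter⁺ (headAtMost? k) (overpartitions-unique n)

  following-unique : ∀ k n → Unique (following k n)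
  following-unique k n = Unique.filter⁺ (canFollow? k) (overpartitions-unique n)

  ∈-bounded⁺ : ∀ {k n π} → π IsOverpartitionOf n → HeadAtMost k π → π ∈ bounded k n
  ∈-bounded⁺ o h = ∈-filter⁺ (headAtMost? _) (Equivalence.from (∈-overpartitions _ _) o) h

  ∈-bounded⁻ : ∀ {k n π} → π ∈ bounded k n → π IsOverpartitionOf n × HeadAtMost k π
  ∈-bounded⁻ {k} {n} π∈ with ∈-filter⁻ (headAtMost? k) {xs = overpartitions n} π∈
  ... | π∈o , h = Equivalence.to (∈-overpartitions _ _) π∈o , h

  ∈-following⁺ : ∀ {k n π} → π IsOverpartitionOf n → CanFollow k π → π ∈ following k n
  ∈-following⁺ o h = ∈-filter⁺ (canFollow? _) (Equivalence.from (∈-overpartitions _ _) o) h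

  ∈-following⁻ : ∀ {k n π} → π ∈ following k n → π IsOverpartitionOf n × CanFollow k π
  ∈-following⁻ {k} {n} π∈ with ∈-filter⁻ (canFollow? k) {xs = overpartitions n} π∈
  ... | π∈o , h = Equivalence.to (∈-overpartitions _ _) π∈o , h

  bounded-stable : ∀ {k n} → n ≤ k → length (bounded k n) ≡ p̄ n
  bounded-stable {k} {n} n≤k = cong length (filter-all (headAtMost? k) (All.tabulate small))
    where
    small : ∀ {π} → π ∈ overpartitions n → HeadAtMost k π
    small {[]}    _  = tt
    small {p ∷ π} π∈ with Equivalence.to (∈-overpartitions n (p ∷ π)) π∈
    ... | isOverpartition _ _ refl = ℕ.≤-trans (ℕ.m≤m+n (size p) _) n≤k

tail-overpartition : ∀ {p π n} → (p ∷ π) IsOverpartitionOf n →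
                     ∃ λ i → size p ℕ.+ i ≡ n × π ∈ following (size p) i
tail-overpartition {p} {π} (isOverpartition (_ ∷ pos) ord tot) =
  sum (map size π) , tot , ∈-following⁺ (isOverpartition pos (Linked.tail ord) refl) (follows ord)
  where
  follows : ∀ {π} → Linked _CanPrecede_ (p ∷ π) → CanFollow (size p) π
  follows [-]     = tt
  follows (r ∷ _) = r

cons-overpartition : ∀ {k b π i} → π ∈ following (suc k) i →
                     (part (suc k) b ∷ π) IsOverpartitionOf (suc k ℕ.+ i)
cons-overpartition {k} {b} π∈ with ∈-following⁻ π∈
... | isOverpartition pos ord tot , f =
  isOverpartition (z<s ∷ pos) (linked ord f) (cong (suc k ℕ.+_) tot)
  where
  linked : ∀ {π} → Linked _CanPrecede_ π → CanFollow (suc k) π → Linked _CanPrecede_ (part (suc k) b ∷ π)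
  linked []        _ = [-]
  linked ord@[-]     r = r ∷ ord
  linked ord@(_ ∷ _) r = r ∷ ord

withLargest : ℕ → Bool → ℕ → List (List Part)
withLargest k b i = map (part k b ∷_) (following k i)

withLargest-unique : ∀ k b i → Unique (withLargest k b i)
withLargest-unique k b i = Unique.map⁺ ∷-injectiveʳ (following-unique k i)

∈-withLargest⁻ : ∀ k b n {π} → π ∈ shift [] (suc k) (withLargest (suc k) b) n →
                 π IsOverpartitionOf n × ∃ λ ρ → π ≡ part (suc k) b ∷ ρ
∈-withLargest⁻ k b n π∈ with ∈-shift⁻ (suc k) _ n π∈
... | i , refl , π∈ with ∈-map⁻ (part (suc k) b ∷_) π∈
... | ρ , ρ∈ , refl = cons-overpartition ρ∈ , ρ , refl

∈-withLargest⁺ : ∀ {k b n π} → (part k b ∷ π) IsOverpartitionOf n →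
                 (part k b ∷ π) ∈ shift [] k (withLargest k b) n
∈-withLargest⁺ {k} {b} o with tail-overpartition o
... | i , refl , π∈ = ∈-shift⁺ k (withLargest k b) i (∈-map⁺ (part k b ∷_) π∈)

-- Either every part is at most `k`, or the list starts with a plain part of size k+1, whose tail
-- can again follow a part of that size. As series, F = B + q^{k+1} F.
following-split : ∀ k n → length (following (suc k) n) ≡
  length (bounded k n ++ shift [] (suc k) (withLargest (suc k) false) n)
following-split k n = length-unique (following-unique (suc k) n)
  (Unique.++⁺ (bounded-unique k n) (shift-unique (suc k) _ n (withLargest-unique (suc k) false)) disjoint)
  to from
  where
  disjoint : Disjoint (bounded k n) (shift [] (suc k) (withLargest (suc k) false) n)
  disjoint (π∈b , π∈w) with ∈-withLargest⁻ k false n π∈w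
  ... | _ , _ , refl = ℕ.1+n≰n (proj₂ (∈-bounded⁻ π∈b))

  to : ∀ {π} → π ∈ following (suc k) n →
       π ∈ bounded k n ++ shift [] (suc k) (withLargest (suc k) false) n
  to {π} π∈ with ∈-following⁻ {suc k} π∈
  to {[]}    _ | o , _             = ∈-++⁺ˡ (∈-bounded⁺ o tt)
  to {p ∷ π} _ | o , inj₁ p<       = ∈-++⁺ˡ (∈-bounded⁺ o (s≤s⁻¹ p<))
  to {p ∷ π} _ | o , inj₂ (refl , refl) = ∈-++⁺ʳ (bounded k n) (∈-withLargest⁺ o)

  from : ∀ {π} → π ∈ bounded k n ++ shift [] (suc k) (withLargest (suc k) false) n →
         π ∈ following (suc k) n
  from {π} π∈ with ∈-++⁻ (bounded k n) π∈
  from {π} _ | inj₂ π∈w with ∈-withLargest⁻ k false n π∈w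
  ... | o , _ , refl = ∈-following⁺ o (inj₂ (refl , refl))
  from {π} _ | inj₁ π∈b with ∈-bounded⁻ {k} π∈b
  from {[]}    _ | inj₁ _ | o , _  = ∈-following⁺ o tt
  from {p ∷ π} _ | inj₁ _ | o , p≤ = ∈-following⁺ o (inj₁ (s≤s p≤))

-- With parts at most k+1, only an overlined first part of size k+1 is unable to follow a part of
-- size k+1, and its tail is able to. This yields the factor 1 + q^{k+1}.
bounded-split : ∀ k n → length (bounded (suc k) n) ≡
  length (following (suc k) n ++ shift [] (suc k) (withLargest (suc k) true) n)
bounded-split k n = length-unique (bounded-unique (suc k) n)
  (Unique.++⁺ (following-unique (suc k) n) (shift-unique (suc k) _ n (withLargest-unique (suc k) true)) disjoint)
  to from
  where
  disjoint : Disjoint (following (suc k) n) (shift [] (suc k) (withLargest (suc k) true) n)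
  disjoint (π∈f , π∈w) with ∈-withLargest⁻ k true n π∈w
  ... | _ , _ , refl with proj₂ (∈-following⁻ {suc k} π∈f)
  ... | inj₁ k<k = ℕ.1+n≰n k<k
  ... | inj₂ (_ , ())

  to : ∀ {π} → π ∈ bounded (suc k) n →
       π ∈ following (suc k) n ++ shift [] (suc k) (withLargest (suc k) true) n
  to {π} π∈ with ∈-bounded⁻ {suc k} π∈
  to {[]}    _ | o , _ = ∈-++⁺ˡ (∈-following⁺ o tt)
  to {part s b ∷ π} _ | o , s≤ with ℕ.m≤n⇒m<n∨m≡n s≤
  to {part s b     ∷ π} _ | o , s≤ | inj₁ s<   = ∈-++⁺ˡ (∈-following⁺ o (inj₁ s<))
  to {part s false ∷ π} _ | o , s≤ | inj₂ refl = ∈-++⁺ˡ (∈-following⁺ o (inj₂ (refl , refl)))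
  to {part s true  ∷ π} _ | o , s≤ | inj₂ refl = ∈-++⁺ʳ (following (suc k) n) (∈-withLargest⁺ o)

  from : ∀ {π} → π ∈ following (suc k) n ++ shift [] (suc k) (withLargest (suc k) true) n →
         π ∈ bounded (suc k) n
  from {π} π∈ with ∈-++⁻ (following (suc k) n) π∈
  from {π} _ | inj₂ π∈w with ∈-withLargest⁻ k true n π∈w
  ... | o , _ , refl = ∈-bounded⁺ o ℕ.≤-refl
  from {π} _ | inj₁ π∈f with ∈-following⁻ {suc k} π∈f
  from {[]}    _ | inj₁ _ | o , _             = ∈-bounded⁺ o tt
  from {p ∷ π} _ | inj₁ _ | o , inj₁ p<       = ∈-bounded⁺ o (ℕ.<⇒≤ p<)
  from {p ∷ π} _ | inj₁ _ | o , inj₂ (refl , _) = ∈-bounded⁺ o ℕ.≤-refl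

bounded-zero : ∀ n → length (bounded 0 (suc n)) ≡ 0
bounded-zero n with bounded 0 (suc n) in eq
... | []    = refl
... | π ∷ _ = ⊥-elim (absurd (∈-bounded⁻ {0} {suc n} {π} (subst (π ∈_) (sym eq) (here refl))))
  where
  absurd : ∀ {π} → π IsOverpartitionOf (suc n) × HeadAtMost 0 π → ⊥
  absurd {[]}    (isOverpartition _ _ () , _)
  absurd {p ∷ π} (isOverpartition (0<p ∷ _) _ _ , p≤0) = ℕ.n≮0 (ℕ.<-≤-trans 0<p p≤0)

-- Operators on formal power series

-- k ▷ f is qᵏ f.
infixr 8 _▷_
_▷_ : ℕ → (ℕ → ℤ) → ℕ → ℤ
k ▷ f = shift 0ℤ k f

▷-cong : ∀ k {f g} → f ≗ g → k ▷ f ≗ k ▷ g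
▷-cong k f≗g n = shift-cong 0ℤ k n (λ i _ → f≗g i)

▷-suc-cong : ∀ k {f g} n → (∀ i → i < n → f i ≡ g i) → (suc k ▷ f) n ≡ (suc k ▷ g) n
▷-suc-cong k n f≡g = shift-cong 0ℤ (suc k) n
  (λ { i refl → f≡g i (s≤s (ℕ.m≤n+m i k)) })

▷-▷ : ∀ k l f n → (k ▷ l ▷ f) n ≡ ((k ℕ.+ l) ▷ f) n
▷-▷ zero    l f n       = refl
▷-▷ (suc k) l f zero    = refl
▷-▷ (suc k) l f (suc n) = ▷-▷ k l f n

▷-+ : ∀ k f g n → (k ▷ (λ i → f i + g i)) n ≡ (k ▷ f) n + (k ▷ g) n
▷-+ zero    f g n       = refl
▷-+ (suc k) f g zero    = refl
▷-+ (suc k) f g (suc n) = ▷-+ k f g n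

▷-- : ∀ k f g n → (k ▷ (λ i → f i - g i)) n ≡ (k ▷ f) n - (k ▷ g) n
▷-- zero    f g n       = refl
▷-- (suc k) f g zero    = refl
▷-- (suc k) f g (suc n) = ▷-- k f g n

▷-* : ∀ k c f n → (k ▷ (λ i → c * f i)) n ≡ c * (k ▷ f) n
▷-* zero    c f n       = refl
▷-* (suc k) c f zero    = sym (ℤ.*-zeroʳ c)
▷-* (suc k) c f (suc n) = ▷-* k c f n

▷-zero : ∀ k n → (k ▷ (λ _ → 0ℤ)) n ≡ 0ℤ
▷-zero zero    n       = refl
▷-zero (suc k) zero    = refl
▷-zero (suc k) (suc n) = ▷-zero k n

▷-vanishes : ∀ k {f} n → (∀ i → f i ≡ 0ℤ) → (k ▷ f) n ≡ 0ℤ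
▷-vanishes k n f≡0 = trans (▷-cong k f≡0 n) (▷-zero k n)

▷-below : ∀ k f {n} → n < k → (k ▷ f) n ≡ 0ℤ
▷-below (suc k) f {zero}  _         = refl
▷-below (suc k) f {suc n} (s≤s n<k) = ▷-below k f n<k

-- ∇ k f is (1 − qᵏ) f.
∇ : ℕ → (ℕ → ℤ) → ℕ → ℤ
∇ k f n = f n - (k ▷ f) n

∇-cong : ∀ k {f g} → f ≗ g → ∇ k f ≗ ∇ k g
∇-cong k f≗g n = cong₂ _-_ (f≗g n) (▷-cong k f≗g n)

∇-+ : ∀ k f g n → ∇ k (λ i → f i + g i) n ≡ ∇ k f n + ∇ k g n
∇-+ k f g n = trans (cong (λ z → f n + g n - z) (▷-+ k f g n)) (lemma (f n) (g n) ((k ▷ f) n) ((k ▷ g) n))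
  where
  lemma : ∀ a b c d → a + b - (c + d) ≡ (a - c) + (b - d)
  lemma = solve-∀

▷-comm : ∀ k l f n → (k ▷ l ▷ f) n ≡ (l ▷ k ▷ f) n
▷-comm k l f n = trans (▷-▷ k l f n)
  (trans (cong (λ x → (x ▷ f) n) (ℕ.+-comm k l)) (sym (▷-▷ l k f n)))

∇-▷ : ∀ k l f n → ∇ k (l ▷ f) n ≡ (l ▷ ∇ k f) n
∇-▷ k l f n = trans (cong (λ z → (l ▷ f) n - z) (▷-comm k l f n)) (sym (▷-- l f (k ▷ f) n))

∇-comm : ∀ k l f n → ∇ k (∇ l f) n ≡ ∇ l (∇ k f) n
∇-comm k l f n = trans (cong (λ z → f n - (l ▷ f) n - z) (▷-- k f (l ▷ f) n))
  (trans (cong (λ z → f n - (l ▷ f) n - ((k ▷ f) n - z)) (▷-comm k l f n))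
  (trans (lemma (f n) ((l ▷ f) n) ((k ▷ f) n) ((l ▷ k ▷ f) n))
         (sym (cong (λ z → f n - (k ▷ f) n - z) (▷-- l f (k ▷ f) n)))))
  where
  lemma : ∀ a b c d → a - b - (c - d) ≡ a - c - (b - d)
  lemma = solve-∀

-- (1 - qᵏ) + qᵏ(1 - qˡ) = 1 - q^{k+l}, the algebra behind the Pascal rule below.
∇-merge : ∀ k l f n → ∇ k f n + (k ▷ ∇ l f) n ≡ ∇ (k ℕ.+ l) f n
∇-merge k l f n = trans (cong (λ z → ∇ k f n + z) (trans (▷-- k f (l ▷ f) n) (cong ((k ▷ f) n -_) (▷-▷ k l f n))))
  (lemma (f n) ((k ▷ f) n) (((k ℕ.+ l) ▷ f) n))
  where
  lemma : ∀ a b c → a - b + (b - c) ≡ a - c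
  lemma = solve-∀

i+j-j≡i : ∀ i j → i + j - j ≡ i
i+j-j≡i = solve-∀

i-j+j≡i : ∀ i j → i - j + j ≡ i
i-j+j≡i = solve-∀

-- Coefficient n of q^{k+1} f involves only coefficients of f below n, so strong induction applies.
-- Identities between quotients are proved by clearing denominators with this.
∇-suc-injective : ∀ k f g → ∇ (suc k) f ≗ ∇ (suc k) g → f ≗ g
∇-suc-injective k f g eq n = below (suc n) n ℕ.≤-refl
  where
  cancel : ∀ a b c → a - c ≡ b - c → a ≡ b
  cancel a b c e = trans (sym (i-j+j≡i a c)) (trans (cong (_+ c) e) (i-j+j≡i b c))

  below : ∀ N n → n < N → f n ≡ g n
  below (suc N) n (s≤s n≤N) = cancel (f n) (g n) _ (trans (eq n) (cong (g n -_)
    (▷-suc-cong k n (λ i i<n → sym (below N i (ℕ.<-≤-trans i<n n≤N))))))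

-- Iterates g = f + q^{k+1} g with `N` as fuel, the recursion on the degree not being structural;
-- coefficient n is final once N > n.
module Quotient (k : ℕ) (f : ℕ → ℤ) where

  approx : ℕ → ℕ → ℤ
  approx zero    n = 0ℤ
  approx (suc N) n = f n + (suc k ▷ approx N) n

  approx-stable : ∀ N M n → n < N → n < M → approx N n ≡ approx M n
  approx-stable (suc N) (suc M) n (s≤s n≤N) (s≤s n≤M) = cong (λ z → f n + z)
    (▷-suc-cong k n (λ i i<n → approx-stable N M i (ℕ.<-≤-trans i<n n≤N) (ℕ.<-≤-trans i<n n≤M)))

-- f / (1 − q^{k+1})
quot : ℕ → (ℕ → ℤ) → ℕ → ℤ
quot k f n = Quotient.approx k f (suc n) n

∇-quot : ∀ k f → ∇ (suc k) (quot k f) ≗ f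
∇-quot k f n = trans
  (cong (λ z → f n + z - (suc k ▷ quot k f) n)
    (▷-suc-cong k n (λ i i<n → Quotient.approx-stable k f n (suc i) i i<n ℕ.≤-refl)))
  (i+j-j≡i (f n) ((suc k ▷ quot k f) n))

-- Finite sums and signs

∑ : ℕ → (ℕ → ℤ) → ℤ
∑ zero    g = 0ℤ
∑ (suc n) g = ∑ n g + g n

∑-cong : ∀ n {g h} → (∀ i → i < n → g i ≡ h i) → ∑ n g ≡ ∑ n h
∑-cong zero    g≡h = refl
∑-cong (suc n) g≡h = cong₂ _+_ (∑-cong n (λ i i<n → g≡h i (ℕ.m<n⇒m<1+n i<n))) (g≡h n ℕ.≤-refl)

∑-+ : ∀ n g h → ∑ n (λ i → g i + h i) ≡ ∑ n g + ∑ n h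
∑-+ zero    g h = refl
∑-+ (suc n) g h = trans (cong (_+ (g n + h n)) (∑-+ n g h)) (lemma (∑ n g) (∑ n h) (g n) (h n))
  where
  lemma : ∀ a b c d → a + b + (c + d) ≡ a + c + (b + d)
  lemma = solve-∀

∑-* : ∀ n c g → ∑ n (λ i → c * g i) ≡ c * ∑ n g
∑-* zero    c g = sym (ℤ.*-zeroʳ c)
∑-* (suc n) c g = trans (cong (_+ c * g n) (∑-* n c g)) (sym (ℤ.*-distribˡ-+ c (∑ n g) (g n)))

∑-zero : ∀ n {g} → (∀ i → i < n → g i ≡ 0ℤ) → ∑ n g ≡ 0ℤ
∑-zero zero    g≡0 = refl
∑-zero (suc n) g≡0 = cong₂ _+_ (∑-zero n (λ i i<n → g≡0 i (ℕ.m<n⇒m<1+n i<n))) (g≡0 n ℕ.≤-refl)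

sgn : ℕ → ℤ
sgn n = -1ℤ ^ n

-- The sign flips at each step, so the summand is `sgn (suc i) * e (suc i) - sgn i * e i`.
∑-telescope : ∀ n (e : ℕ → ℤ) → ∑ n (λ i → sgn (suc i) * (e i + e (suc i))) ≡ sgn n * e n - e 0
∑-telescope zero    e = lemma (e 0)
  where
  lemma : ∀ a → 0ℤ ≡ 1ℤ * a - a
  lemma = solve-∀
∑-telescope (suc n) e = trans (cong (_+ sgn (suc n) * (e n + e (suc n))) (∑-telescope n e))
  (lemma (sgn n) (e n) (e (suc n)) (e 0))
  where
  lemma : ∀ s a b c → s * a - c + -1ℤ * s * (a + b) ≡ -1ℤ * s * b - c
  lemma = solve-∀

δ : ℕ → ℤ
δ zero    = 1ℤ
δ (suc n) = 0ℤ

-- A finite form of Gauss's identity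

module FiniteGauss
  (A : ℕ → ℕ → ℤ) (A-zero : A 0 ≗ δ)
  (A-suc : ∀ n m → ∇ (suc n) (A (suc n)) m ≡ A n m + (suc n ▷ A n) m)
  where

  -- For A n = ∏_{k ≤ n} (1 + qᵏ)/(1 − qᵏ) and i, j ≤ n, this gives a n j = (q²;q²)ₙ / ((q)ₙ₋ⱼ (q)ₙ₊ⱼ)
  -- and b n i = (q²;q²)ₙ / ((q)ₙ₋ᵢ (q)ₙ₊ᵢ₊₁).
  mutual
    a : ℕ → ℕ → ℕ → ℤ
    a n zero    = A n
    a n (suc i) = ∇ (n ∸ i) (b n i)

    b : ℕ → ℕ → ℕ → ℤ
    b n i = quot (n ℕ.+ i) (a n i)

  ∇-b : ∀ n i → ∇ (suc (n ℕ.+ i)) (b n i) ≗ a n i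
  ∇-b n i = ∇-quot (n ℕ.+ i) (a n i)

  -- In closed form, over the common denominator (q)ₙ₋ⱼ (q)ₙ₊ⱼ₊₂, this is 1 - q^{2n+2} = (1 -
  -- q^{n+j+2}) + q^{n+j+2}(1 - q^{n-j}).
  Pascal : ℕ → ℕ → Set
  Pascal n j = ∀ m → a (suc n) (suc j) m ≡ b n j m + (suc (suc (n ℕ.+ j)) ▷ b n (suc j)) m

  -- The Pascal rule at j = -1, where the closed form of b is symmetric: its values at -1 and 0
  -- coincide.
  a-suc-zero : ∀ n m → a (suc n) 0 m ≡ b n 0 m + (suc n ▷ b n 0) m
  a-suc-zero n = ∇-suc-injective n _ _ eq
    where
    ∇b : ∇ (suc n) (b n 0) ≗ A n
    ∇b = subst (λ k → ∇ (suc k) (b n 0) ≗ A n) (ℕ.+-identityʳ n) (∇-b n 0)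

    eq : ∇ (suc n) (A (suc n)) ≗ ∇ (suc n) (λ m → b n 0 m + (suc n ▷ b n 0) m)
    eq m = trans (A-suc n m) (sym (trans (∇-+ (suc n) (b n 0) (suc n ▷ b n 0) m)
      (cong₂ _+_ (∇b m) (trans (∇-▷ (suc n) (suc n) (b n 0) m) (▷-cong (suc n) ∇b m)))))

  exponents : ∀ n i → i ≤ n → suc (suc (n ℕ.+ i)) ℕ.+ (n ∸ i) ≡ suc n ℕ.+ suc n
  exponents n i i≤n = trans
    (cong (suc ∘ suc) (trans (ℕ.+-assoc n i (n ∸ i)) (cong (n ℕ.+_) (ℕ.m+[n∸m]≡n i≤n))))
    (cong suc (sym (ℕ.+-suc n n)))

  mutual
    -- In closed form both sides are (q²;q²)ₙ₊₁ / ((q)ₙ₋ᵢ (q)ₙ₊ᵢ₊₁). The induction alternates: this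
    -- at `i` gives `pascal` at `i`, which gives this at `suc i`.
    ∇-a-suc : ∀ n i → i ≤ n → ∇ (suc n ∸ i) (a (suc n) i) ≗ ∇ (suc n ℕ.+ suc n) (b n i)
    ∇-a-suc n zero    _   m = begin
      ∇ (suc n) (a (suc n) 0) m
        ≡⟨ ∇-cong (suc n) (a-suc-zero n) m ⟩
      ∇ (suc n) (λ i → b n 0 i + (suc n ▷ b n 0) i) m
        ≡⟨ ∇-+ (suc n) (b n 0) (suc n ▷ b n 0) m ⟩
      ∇ (suc n) (b n 0) m + ∇ (suc n) (suc n ▷ b n 0) m
        ≡⟨ cong (λ z → ∇ (suc n) (b n 0) m + z) (∇-▷ (suc n) (suc n) (b n 0) m) ⟩
      ∇ (suc n) (b n 0) m + (suc n ▷ ∇ (suc n) (b n 0)) m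
        ≡⟨ ∇-merge (suc n) (suc n) (b n 0) m ⟩
      ∇ (suc n ℕ.+ suc n) (b n 0) m ∎
      where open ≡-Reasoning
    ∇-a-suc n (suc i) i<n m = begin
      ∇ d (a (suc n) (suc i)) m
        ≡⟨ ∇-cong d (pascal n i (ℕ.<⇒≤ i<n)) m ⟩
      ∇ d (λ m → b n i m + (k ▷ b n (suc i)) m) m
        ≡⟨ ∇-+ d (b n i) (k ▷ b n (suc i)) m ⟩
      -- `∇ d (b n i)` is `a n (suc i)` by definition; rewriting it through `∇-b` makes both
      -- summands multiples of `b n (suc i)`, ready to merge.
      a n (suc i) m + ∇ d (k ▷ b n (suc i)) m
        ≡⟨ cong₂ _+_ (sym (∇-b n (suc i) m)) (∇-▷ d k (b n (suc i)) m) ⟩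
      ∇ (suc (n ℕ.+ suc i)) (b n (suc i)) m + (k ▷ ∇ d (b n (suc i))) m
        ≡⟨ cong (λ x → ∇ (suc x) (b n (suc i)) m + (k ▷ ∇ d (b n (suc i))) m) (ℕ.+-suc n i) ⟩
      ∇ k (b n (suc i)) m + (k ▷ ∇ d (b n (suc i))) m
        ≡⟨ ∇-merge k d (b n (suc i)) m ⟩
      ∇ (k ℕ.+ d) (b n (suc i)) m
        ≡⟨ cong (λ x → ∇ x (b n (suc i)) m) (exponents n i (ℕ.<⇒≤ i<n)) ⟩
      ∇ (suc n ℕ.+ suc n) (b n (suc i)) m ∎
      where
      open ≡-Reasoning
      d = n ∸ i
      k = suc (suc (n ℕ.+ i))

    pascal : ∀ n i → i ≤ n → Pascal n i
    -- Multiplying by 1 - q^{n+i+2} cancels the division in `b (suc n) i`, which leaves the left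
    -- side of `∇-a-suc` at `i`.
    pascal n i i≤n = ∇-suc-injective (suc n ℕ.+ i) _ _ eq
      where
      open ≡-Reasoning
      k = suc (suc n ℕ.+ i)
      d = n ∸ i
      ∇b : ∇ k (b n (suc i)) ≗ a n (suc i)
      ∇b = subst (λ x → ∇ (suc x) (b n (suc i)) ≗ a n (suc i)) (ℕ.+-suc n i) (∇-b n (suc i))

      eq : ∇ k (a (suc n) (suc i)) ≗ ∇ k (λ m → b n i m + (k ▷ b n (suc i)) m)
      eq m = begin
        ∇ k (∇ (suc n ∸ i) (b (suc n) i)) m
          ≡⟨ ∇-comm k (suc n ∸ i) (b (suc n) i) m ⟩
        ∇ (suc n ∸ i) (∇ k (b (suc n) i)) m
          ≡⟨ ∇-cong (suc n ∸ i) (∇-b (suc n) i) m ⟩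
        ∇ (suc n ∸ i) (a (suc n) i) m
          ≡⟨ ∇-a-suc n i i≤n m ⟩
        ∇ (suc n ℕ.+ suc n) (b n i) m
          ≡⟨ cong (λ x → ∇ x (b n i) m) (exponents n i i≤n) ⟨
        ∇ (k ℕ.+ d) (b n i) m
          ≡⟨ ∇-merge k d (b n i) m ⟨
        ∇ k (b n i) m + (k ▷ a n (suc i)) m
          ≡⟨ cong (λ z → ∇ k (b n i) m + z) (▷-cong k ∇b m) ⟨
        ∇ k (b n i) m + (k ▷ ∇ k (b n (suc i))) m
          ≡⟨ cong (λ z → ∇ k (b n i) m + z) (∇-▷ k k (b n (suc i)) m) ⟨
        ∇ k (b n i) m + ∇ k (k ▷ b n (suc i)) m
          ≡⟨ ∇-+ k (b n i) (k ▷ b n (suc i)) m ⟨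
        ∇ k (λ m → b n i m + (k ▷ b n (suc i)) m) m ∎

  -- `∇ 0` multiplies by 1 - q⁰ = 0, so the sum over j ends by itself at j = n.
  a-vanishes : ∀ n m → a n (suc n) m ≡ 0ℤ
  a-vanishes n m = trans (cong (λ x → ∇ x (b n n) m) (ℕ.n∸n≡0 n)) (ℤ.+-inverseʳ (b n n m))

  b-vanishes : ∀ n m → b n (suc n) m ≡ 0ℤ
  b-vanishes n = ∇-suc-injective (n ℕ.+ suc n) _ (λ _ → 0ℤ)
    (λ m → trans (∇-b n (suc n) m) (trans (a-vanishes n m)
      (sym (cong (λ z → 0ℤ - z) (▷-zero (suc (n ℕ.+ suc n)) m)))))

  mutual
    -- Going from `a n i` through `b n i` to `a n (suc i)` divides by 1 - q^{n+i+1} and multiplies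
    -- by 1 - q^{n-i}. As long as m + i < n, both exponents exceed the degree m.
    a-truncated : ∀ n j m → m ℕ.+ j ≤ n → a n j m ≡ A n m
    a-truncated n zero    m _   = refl
    a-truncated n (suc i) m m+j≤n = trans
      (cong (λ z → b n i m - z) (▷-below (n ∸ i) (b n i) (ℕ.m+n≤o⇒m≤o∸n (suc m) m+i<n)))
      (trans (ℤ.+-identityʳ (b n i m)) (b-truncated n i m (ℕ.<⇒≤ m+i<n)))
      where
      m+i<n : m ℕ.+ i < n
      m+i<n = subst (_≤ n) (ℕ.+-suc m i) m+j≤n

    b-truncated : ∀ n i m → m ℕ.+ i ≤ n → b n i m ≡ A n m
    b-truncated n i m m+i≤n = trans
      (trans (sym (ℤ.+-identityʳ (b n i m)))
        (cong (λ z → b n i m - z) (sym (▷-below (suc (n ℕ.+ i)) (b n i) m<))))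
      (trans (∇-b n i m) (a-truncated n i m m+i≤n))
      where
      m< : m < suc (n ℕ.+ i)
      m< = s≤s (ℕ.≤-trans (ℕ.m≤m+n m i) (ℕ.≤-trans m+i≤n (ℕ.m≤m+n n i)))

  -- Index `i` stands for j = i+1; the factor 2 in `gauss-sum` accounts for j and -j together.
  term : ℕ → ℕ → ℕ → ℤ
  term n m i = sgn (suc i) * ((suc i ℕ.* suc i) ▷ a n (suc i)) m

  gauss-sum : ℕ → ℕ → ℤ
  gauss-sum n m = a n 0 m + + 2 * ∑ n (term n m)

  module _ (n m : ℕ) where

    -- What the increments at j = i and j = i+1 share up to sign.
    edge : ℕ → ℤ
    edge i = ((suc n ℕ.+ i ℕ.* suc i) ▷ b n i) m

    -- By `pascal`, `a (suc n) (suc i)` exceeds `a n (suc i)` by q^{n-i} b(n,i) + q^{n+i+2}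
    -- b(n,i+1). The factor q^{(i+1)²} turns the exponents into n+1+i(i+1) and n+1+(i+1)(i+2).
    term-suc : ∀ i → i ≤ n → term (suc n) m i ≡ term n m i + sgn (suc i) * (edge i + edge (suc i))
    term-suc i i≤n = trans (cong (sgn (suc i) *_) shifted) (ℤ.*-distribˡ-+ (sgn (suc i)) _ (edge i + edge (suc i)))
      where
      open ≡-Reasoning
      s = suc i ℕ.* suc i
      k = suc (suc (n ℕ.+ i))
      d = n ∸ i

      split : ∀ x y z → x + z ≡ (x - y) + (y + z)
      split = solve-∀

      difference : ∀ m → a (suc n) (suc i) m ≡ a n (suc i) m + ((d ▷ b n i) m + (k ▷ b n (suc i)) m)
      difference m = trans (pascal n i i≤n m) (split (b n i m) ((d ▷ b n i) m) ((k ▷ b n (suc i)) m))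

      s+d : s ℕ.+ d ≡ suc n ℕ.+ i ℕ.* suc i
      s+d = trans (lemma i d) (cong (λ x → suc x ℕ.+ i ℕ.* suc i) (ℕ.m+[n∸m]≡n i≤n))
        where
        lemma : ∀ i d → suc i ℕ.* suc i ℕ.+ d ≡ suc (i ℕ.+ d) ℕ.+ i ℕ.* suc i
        lemma = ℕ.solve-∀

      s+k : ∀ i n → suc i ℕ.* suc i ℕ.+ suc (suc (n ℕ.+ i)) ≡ suc n ℕ.+ suc i ℕ.* suc (suc i)
      s+k = ℕ.solve-∀

      shifted : (s ▷ a (suc n) (suc i)) m ≡ (s ▷ a n (suc i)) m + (edge i + edge (suc i))
      shifted = begin
        (s ▷ a (suc n) (suc i)) m
          ≡⟨ ▷-cong s difference m ⟩
        (s ▷ (λ m → a n (suc i) m + ((d ▷ b n i) m + (k ▷ b n (suc i)) m))) m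
          ≡⟨ ▷-+ s (a n (suc i)) _ m ⟩
        (s ▷ a n (suc i)) m + (s ▷ (λ m → (d ▷ b n i) m + (k ▷ b n (suc i)) m)) m
          ≡⟨ cong (λ z → (s ▷ a n (suc i)) m + z) (▷-+ s (d ▷ b n i) (k ▷ b n (suc i)) m) ⟩
        (s ▷ a n (suc i)) m + ((s ▷ d ▷ b n i) m + (s ▷ k ▷ b n (suc i)) m)
          ≡⟨ cong (λ z → (s ▷ a n (suc i)) m + z) (cong₂ _+_
               (trans (▷-▷ s d (b n i) m) (cong (λ x → (x ▷ b n i) m) s+d))
               (trans (▷-▷ s k (b n (suc i)) m) (cong (λ x → (x ▷ b n (suc i)) m) (s+k i n)))) ⟩
        (s ▷ a n (suc i)) m + (edge i + edge (suc i)) ∎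

    a-zero-suc : a (suc n) 0 m ≡ a n 0 m + + 2 * edge 0
    a-zero-suc = trans (a-suc-zero n m)
      (trans (split (b n 0 m) ((suc n ▷ b n 0) m))
        (cong₂ _+_
          (trans (cong (λ x → ∇ (suc x) (b n 0) m) (sym (ℕ.+-identityʳ n))) (∇-b n 0 m))
          (cong (λ x → + 2 * (suc x ▷ b n 0) m) (sym (ℕ.+-identityʳ n)))))
      where
      split : ∀ x y → x + y ≡ (x - y) + + 2 * y
      split = solve-∀

    edge-last : edge (suc n) ≡ 0ℤ
    edge-last = ▷-vanishes (suc n ℕ.+ suc n ℕ.* suc (suc n)) m (b-vanishes n)

    term-last : term n m n ≡ 0ℤ
    term-last = trans (cong (sgn (suc n) *_)
      (▷-vanishes (suc n ℕ.* suc n) m (a-vanishes n))) (ℤ.*-zeroʳ (sgn (suc n)))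

    gauss-sum-suc : gauss-sum (suc n) m ≡ gauss-sum n m
    gauss-sum-suc = begin
      a (suc n) 0 m + + 2 * ∑ (suc n) (term (suc n) m)
        ≡⟨ cong₂ (λ x y → x + + 2 * y) a-zero-suc
             (trans (∑-cong (suc n) (λ i i<n → term-suc i (s≤s⁻¹ i<n)))
               (∑-+ (suc n) (term n m) (λ i → sgn (suc i) * (edge i + edge (suc i))))) ⟩
      a n 0 m + + 2 * edge 0 + + 2 * (∑ n (term n m) + term n m n + ∑ (suc n) (λ i → sgn (suc i) * (edge i + edge (suc i))))
        -- The index j = n+1 is new: its term at level n is zero, as is the far edge. The -2
        -- `edge 0` left by telescoping cancels the increment at j = 0.
        ≡⟨ cong₂ (λ x y → a n 0 m + + 2 * edge 0 + + 2 * (∑ n (term n m) + x + y)) term-last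
             (trans (∑-telescope (suc n) edge) (cong (λ x → sgn (suc n) * x - edge 0) edge-last)) ⟩
      a n 0 m + + 2 * edge 0 + + 2 * (∑ n (term n m) + 0ℤ + (sgn (suc n) * 0ℤ - edge 0))
        ≡⟨ lemma (a n 0 m) (edge 0) (∑ n (term n m)) (sgn (suc n)) ⟩
      gauss-sum n m ∎
      where
      open ≡-Reasoning
      lemma : ∀ x e t s → x + + 2 * e + + 2 * (t + 0ℤ + (s * 0ℤ - e)) ≡ x + + 2 * t
      lemma = solve-∀

  gauss-sum≡δ : ∀ n m → gauss-sum n m ≡ δ m
  gauss-sum≡δ zero    m = trans (ℤ.+-identityʳ (A 0 m)) (A-zero m)
  gauss-sum≡δ (suc n) m = trans (gauss-sum-suc n m) (gauss-sum≡δ n m)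

-- Generating functions of overpartitions with bounded parts

boundedSeries followingSeries : ℕ → ℕ → ℤ
boundedSeries   k n = + length (bounded k n)
followingSeries k n = + length (following k n)

withLargest-series : ∀ k b n → + length (shift [] k (withLargest k b) n) ≡ (k ▷ followingSeries k) n
withLargest-series k b n = trans (shift-natural (+_ ∘ length) [] k (withLargest k b) n)
  (▷-cong k (λ i → cong +_ (length-map (part k b ∷_) (following k i))) n)

followingSeries-suc : ∀ k → ∇ (suc k) (followingSeries (suc k)) ≗ boundedSeries k
followingSeries-suc k n = trans
  (cong (λ z → z - (suc k ▷ followingSeries (suc k)) n)
    (trans (cong +_ (trans (following-split k n) (length-++ (bounded k n))))
      (cong (λ z → boundedSeries k n + z) (withLargest-series (suc k) false n))))
  (i+j-j≡i (boundedSeries k n) ((suc k ▷ followingSeries (suc k)) n))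

boundedSeries-suc : ∀ k n → ∇ (suc k) (boundedSeries (suc k)) n ≡ boundedSeries k n + (suc k ▷ boundedSeries k) n
boundedSeries-suc k n = begin
  ∇ (suc k) (boundedSeries (suc k)) n
    ≡⟨ ∇-cong (suc k) split n ⟩
  ∇ (suc k) (λ n → B n + (suc k ▷ B) n) n
    ≡⟨ ∇-+ (suc k) B (suc k ▷ B) n ⟩
  ∇ (suc k) B n + ∇ (suc k) (suc k ▷ B) n
    ≡⟨ cong (λ z → ∇ (suc k) B n + z) (∇-▷ (suc k) (suc k) B n) ⟩
  ∇ (suc k) B n + (suc k ▷ ∇ (suc k) B) n
    ≡⟨ cong₂ _+_ (followingSeries-suc k n) (▷-cong (suc k) (followingSeries-suc k) n) ⟩
  boundedSeries k n + (suc k ▷ boundedSeries k) n ∎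
  where
  open ≡-Reasoning
  B = followingSeries (suc k)

  split : ∀ n → boundedSeries (suc k) n ≡ B n + (suc k ▷ B) n
  split n = trans (cong +_ (trans (bounded-split k n) (length-++ (following (suc k) n))))
    (cong (λ z → B n + z) (withLargest-series (suc k) true n))

boundedSeries-zero : boundedSeries 0 ≗ δ
boundedSeries-zero zero    = cong +_ (bounded-stable {0} {0} z≤n)
boundedSeries-zero (suc n) = cong +_ (bounded-zero n)

open FiniteGauss boundedSeries boundedSeries-zero boundedSeries-suc

-- Gauss's identity and its iteration

squareTerm : (ℕ → ℤ) → ℕ → ℕ → ℤ
squareTerm f n i = sgn (suc i) * ((suc i ℕ.* suc i) ▷ f) n

-- Multiplication by ∑_{j ≥ 1} (−1)ʲ q^{j²}.
Θ : (ℕ → ℤ) → ℕ → ℤ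
Θ f n = ∑ n (squareTerm f n)

P : ℕ → ℤ
P n = + p̄ n

-2ℤ : ℤ
-2ℤ = -[1+ 1 ]

-- The finite identity at level n is read off at coefficient n, where every quotient that occurs
-- already agrees with P.
gauss : ∀ n → P n ≡ δ n + -2ℤ * Θ P n
gauss n = begin
  P n                                          ≡⟨ lemma (P n) (Θ P n) ⟩
  P n + + 2 * Θ P n + -2ℤ * Θ P n         ≡⟨ cong (λ z → z + -2ℤ * Θ P n) full ⟨
  gauss-sum n n + -2ℤ * Θ P n             ≡⟨ cong (λ z → z + -2ℤ * Θ P n) (gauss-sum≡δ n n) ⟩
  δ n + -2ℤ * Θ P n                       ∎
  where
  open ≡-Reasoning
  lemma : ∀ p t → p ≡ p + + 2 * t + -2ℤ * t
  lemma = solve-∀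

  agree : ∀ i x → suc i ℕ.* suc i ℕ.+ x ≡ n → a n (suc i) x ≡ P x
  agree i x e = trans (a-truncated n (suc i) x x+i<n) (cong +_ (bounded-stable (ℕ.m+n≤o⇒m≤o x x+i<n)))
    where
    -- With j = i+1 and x = n - j², the bound j ≤ j² puts x in the range of `a-truncated`.
    x+i<n : x ℕ.+ suc i ≤ n
    x+i<n = subst (x ℕ.+ suc i ≤_) (trans (ℕ.+-comm x _) e) (ℕ.+-monoʳ-≤ x (ℕ.m≤m*n (suc i) (suc i)))

  full : gauss-sum n n ≡ P n + + 2 * Θ P n
  full = cong₂ (λ x y → x + + 2 * y) (cong +_ (bounded-stable {n} ℕ.≤-refl))
    (∑-cong n (λ i _ → cong (sgn (suc i) *_) (shift-cong 0ℤ (suc i ℕ.* suc i) n (agree i))))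

Θ-cong : ∀ {f g} → f ≗ g → Θ f ≗ Θ g
Θ-cong f≗g n = ∑-cong n (λ i _ → cong (sgn (suc i) *_) (▷-cong (suc i ℕ.* suc i) f≗g n))

Θ-linear : ∀ c f g n → Θ (λ i → f i + c * g i) n ≡ Θ f n + c * Θ g n
Θ-linear c f g n = trans (∑-cong n (λ i _ → term-linear i))
  (trans (∑-+ n (squareTerm f n) (λ i → c * squareTerm g n i)) (cong (λ z → Θ f n + z) (∑-* n c (squareTerm g n))))
  where
  lemma : ∀ s c x y → s * (x + c * y) ≡ s * x + c * (s * y)
  lemma = solve-∀

  term-linear : ∀ i → squareTerm (λ i → f i + c * g i) n i ≡ squareTerm f n i + c * squareTerm g n i
  term-linear i = trans
    (cong (sgn (suc i) *_) (trans (▷-+ s f (λ i → c * g i) n) (cong (λ z → (s ▷ f) n + z) (▷-* s c g n))))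
    (lemma (sgn (suc i)) c ((s ▷ f) n) ((s ▷ g) n))
    where s = suc i ℕ.* suc i

-- Each substitution of `gauss` into itself gains a factor -2; after three uses `P` survives only
-- under (-2)³.
P-expansion : ∀ n → P n ≡ δ n + -2ℤ * (Θ δ n + -2ℤ * (Θ (Θ δ) n + -2ℤ * Θ (Θ (Θ P)) n))
P-expansion n = trans (gauss n) (cong (λ z → δ n + -2ℤ * z)
  (trans (ΘP n) (cong (λ z → Θ δ n + -2ℤ * z)
    (trans (Θ-cong ΘP n) (Θ-linear -2ℤ (Θ δ) (Θ (Θ P)) n)))))
  where
  ΘP : ∀ n → Θ P n ≡ Θ δ n + -2ℤ * Θ (Θ P) n
  ΘP n = trans (Θ-cong gauss n) (Θ-linear -2ℤ δ (Θ P) n)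

-- Coefficients in residue classes modulo 4

∑-extend : ∀ n d {g} → (∀ i → n ≤ i → g i ≡ 0ℤ) → ∑ (d ℕ.+ n) g ≡ ∑ n g
∑-extend n zero    g≡0 = refl
∑-extend n (suc d) {g} g≡0 = trans (cong₂ _+_ (∑-extend n d g≡0) (g≡0 (d ℕ.+ n) (ℕ.m≤n+m n d))) (ℤ.+-identityʳ (∑ n g))

-- Since index i stands for j = i+1, the surviving odd indices are the even j.
∑-odd : ∀ n {g} → (∀ i → g (i ℕ.* 2) ≡ 0ℤ) → ∑ (n ℕ.* 2) g ≡ ∑ n (λ i → g (suc (i ℕ.* 2)))
∑-odd zero    g≡0 = refl
∑-odd (suc n) {g} g≡0 = cong (_+ g (suc (n ℕ.* 2)))
  (trans (cong₂ _+_ (∑-odd n g≡0) (g≡0 n)) (ℤ.+-identityʳ (∑ n (λ i → g (suc (i ℕ.* 2))))))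

-- For i ≥ n the exponent (i+1)² exceeds n. Longer sums let the coefficients at 4n and n be matched
-- term by term.
Θ-extend : ∀ f n d → ∑ (d ℕ.+ n) (squareTerm f n) ≡ Θ f n
Θ-extend f n d = ∑-extend n d (λ i n≤i → trans
  (cong (sgn (suc i) *_) (▷-below (suc i ℕ.* suc i) f (ℕ.≤-trans (s≤s n≤i) (ℕ.m≤m*n (suc i) (suc i)))))
  (ℤ.*-zeroʳ (sgn (suc i))))

sgn-even : ∀ n → sgn (n ℕ.* 2) ≡ 1ℤ
sgn-even zero    = refl
sgn-even (suc n) = cong (λ z → -1ℤ * (-1ℤ * z)) (sgn-even n)

sgn-+ : ∀ m n → sgn (m ℕ.+ n) ≡ sgn m * sgn n
sgn-+ = ℤ.^-distribˡ-+-* -1ℤ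

sgn-sgn : ∀ n → sgn n * sgn n ≡ 1ℤ
sgn-sgn n = trans (sym (sgn-+ n n)) (trans (cong sgn (lemma n)) (sgn-even n))
  where
  lemma : ∀ n → n ℕ.+ n ≡ n ℕ.* 2
  lemma = ℕ.solve-∀

sgn-square : ∀ n → sgn (n ℕ.* n) ≡ sgn n
sgn-square zero    = refl
sgn-square (suc n) = begin
  sgn (suc n ℕ.* suc n)               ≡⟨ cong sgn (lemma n) ⟩
  sgn (n ℕ.* n ℕ.+ suc (n ℕ.* 2))     ≡⟨ sgn-+ (n ℕ.* n) (suc (n ℕ.* 2)) ⟩
  sgn (n ℕ.* n) * (-1ℤ * sgn (n ℕ.* 2)) ≡⟨ cong₂ (λ x y → x * (-1ℤ * y)) (sgn-square n) (sgn-even n) ⟩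
  sgn n * (-1ℤ * 1ℤ)                  ≡⟨ ℤ.*-comm (sgn n) -1ℤ ⟩
  sgn (suc n)                         ∎
  where
  open ≡-Reasoning
  lemma : ∀ n → suc n ℕ.* suc n ≡ n ℕ.* n ℕ.+ suc (n ℕ.* 2)
  lemma = ℕ.solve-∀

-- For n = k + i, the sign of i is the product of those of k and n.
▷-sgn : ∀ k f n → (k ▷ (λ i → sgn i * f i)) n ≡ sgn k * sgn n * (k ▷ f) n
▷-sgn zero    f n       = cong (_* f n) (sym (ℤ.*-identityˡ (sgn n)))
▷-sgn (suc k) f zero    = sym (ℤ.*-zeroʳ (sgn (suc k) * 1ℤ))
▷-sgn (suc k) f (suc n) = trans (▷-sgn k f n) (lemma (sgn k) (sgn n) ((k ▷ f) n))
  where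
  lemma : ∀ s t x → s * t * x ≡ -1ℤ * s * (-1ℤ * t) * x
  lemma = solve-∀

-- Shifting by a multiple of 4 preserves the residue class. The bound r < 4 serves when n = 0: a
-- positive multiple of 4 then shifts past r.
▷-residue : ∀ r k f n → r < 4 → ((k ℕ.* 4) ▷ f) (r ℕ.+ n ℕ.* 4) ≡ (k ▷ (λ i → f (r ℕ.+ i ℕ.* 4))) n
▷-residue r zero    f n       r<4 = refl
▷-residue r (suc k) f zero    r<4 = ▷-below (suc k ℕ.* 4) f
  (ℕ.<-≤-trans (subst (_< 4) (sym (ℕ.+-identityʳ r)) r<4) (ℕ.m≤m+n 4 (k ℕ.* 4)))
▷-residue r (suc k) f (suc n) r<4 = trans (cong ((suc k ℕ.* 4) ▷ f) (lemma r (n ℕ.* 4))) (▷-residue r k f n r<4)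
  where
  lemma : ∀ r x → r ℕ.+ (4 ℕ.+ x) ≡ 4 ℕ.+ (r ℕ.+ x)
  lemma = ℕ.solve-∀

VanishesAt : ℕ → (ℕ → ℤ) → Set
VanishesAt r f = ∀ m → f (r ℕ.+ m ℕ.* 4) ≡ 0ℤ

▷-residue-vanishes : ∀ r k f n → r < 4 → VanishesAt r f → ((k ℕ.* 4) ▷ f) (r ℕ.+ n ℕ.* 4) ≡ 0ℤ
▷-residue-vanishes r k f n r<4 f≡0 = trans (▷-residue r k f n r<4) (▷-vanishes k n f≡0)

odd-square : ∀ i → suc (i ℕ.* 2) ℕ.* suc (i ℕ.* 2) ≡ suc ((i ℕ.* i ℕ.+ i) ℕ.* 4)
odd-square = ℕ.solve-∀

even-square : ∀ i → (i ℕ.* 2) ℕ.* (i ℕ.* 2) ≡ (i ℕ.* i) ℕ.* 4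
even-square = ℕ.solve-∀

parity : ∀ n → (∃ λ i → n ≡ i ℕ.* 2) ⊎ (∃ λ i → n ≡ suc (i ℕ.* 2))
parity zero    = inj₁ (0 , refl)
parity (suc n) with parity n
... | inj₁ (i , refl) = inj₂ (i , refl)
... | inj₂ (i , refl) = inj₁ (suc i , refl)

-- Subtracting a square, 0 or 1 mod 4, from 3 leaves 3 or 2 mod 4.
Θ-vanishesAt-3 : ∀ f → VanishesAt 2 f → VanishesAt 3 f → VanishesAt 3 (Θ f)
Θ-vanishesAt-3 f f₂ f₃ m = ∑-zero (3 ℕ.+ m ℕ.* 4) (λ i _ →
  trans (cong (sgn (suc i) *_) (square-vanishes (suc i))) (ℤ.*-zeroʳ (sgn (suc i))))
  where
  square-vanishes : ∀ j → ((j ℕ.* j) ▷ f) (3 ℕ.+ m ℕ.* 4) ≡ 0ℤ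
  square-vanishes j with parity j
  ... | inj₁ (i , refl) = trans (cong (λ k → (k ▷ f) (3 ℕ.+ m ℕ.* 4)) (even-square i))
    (▷-residue-vanishes 3 (i ℕ.* i) f m ℕ.≤-refl f₃)
  ... | inj₂ (i , refl) = trans (cong (λ k → (k ▷ f) (3 ℕ.+ m ℕ.* 4)) (odd-square i))
    (▷-residue-vanishes 2 (i ℕ.* i ℕ.+ i) f m (ℕ.n≤1+n 3) f₂)

SignedAtMultiplesOf4 : (ℕ → ℤ) → Set
SignedAtMultiplesOf4 f = ∀ m → f (m ℕ.* 4) ≡ sgn m * f m

-- For odd j, 4n - j² is 3 mod 4 and contributes nothing. For j = 2i the sign is +, and f at 4(n -
-- i²) carries (-1)^{n-i²} = (-1)ⁿ(-1)ⁱ, which supplies the sign of i² in Θ at n.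
Θ-signed : ∀ f → VanishesAt 3 f → SignedAtMultiplesOf4 f → SignedAtMultiplesOf4 (Θ f)
Θ-signed f f₃ f₀ n = begin
  Θ f (n ℕ.* 4)
    -- With 8n indices the sum splits into 4n pairs; the 4n surviving terms are cut back to n at the
    -- end.
    ≡⟨ Θ-extend f (n ℕ.* 4) (n ℕ.* 4) ⟨
  ∑ (n ℕ.* 4 ℕ.+ n ℕ.* 4) (squareTerm f (n ℕ.* 4))
    ≡⟨ cong (λ N → ∑ N (squareTerm f (n ℕ.* 4))) (double (n ℕ.* 4)) ⟩
  ∑ (n ℕ.* 4 ℕ.* 2) (squareTerm f (n ℕ.* 4))
    ≡⟨ ∑-odd (n ℕ.* 4) odd-terms ⟩
  ∑ (n ℕ.* 4) (λ i → squareTerm f (n ℕ.* 4) (suc (i ℕ.* 2)))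
    ≡⟨ ∑-cong (n ℕ.* 4) (λ i _ → even-terms i) ⟩
  ∑ (n ℕ.* 4) (λ i → sgn n * squareTerm f n i)
    ≡⟨ ∑-* (n ℕ.* 4) (sgn n) (squareTerm f n) ⟩
  sgn n * ∑ (n ℕ.* 4) (squareTerm f n)
    ≡⟨ cong (λ N → sgn n * ∑ N (squareTerm f n)) (quadruple n) ⟩
  sgn n * ∑ (n ℕ.* 3 ℕ.+ n) (squareTerm f n)
    ≡⟨ cong (sgn n *_) (Θ-extend f n (n ℕ.* 3)) ⟩
  sgn n * Θ f n ∎
  where
  open ≡-Reasoning
  double : ∀ n → n ℕ.+ n ≡ n ℕ.* 2
  double = ℕ.solve-∀

  quadruple : ∀ n → n ℕ.* 4 ≡ n ℕ.* 3 ℕ.+ n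
  quadruple = ℕ.solve-∀

  odd-vanishes : ∀ k n → (suc (k ℕ.* 4) ▷ f) (n ℕ.* 4) ≡ 0ℤ
  odd-vanishes k zero    = refl
  -- One unit of the shift turns the index 4(n+1) into 3 + 4n.
  odd-vanishes k (suc n) = ▷-residue-vanishes 3 k f n ℕ.≤-refl f₃

  odd-terms : ∀ i → squareTerm f (n ℕ.* 4) (i ℕ.* 2) ≡ 0ℤ
  odd-terms i = trans (cong (sgn (suc (i ℕ.* 2)) *_)
    (trans (cong (λ k → (k ▷ f) (n ℕ.* 4)) (odd-square i)) (odd-vanishes (i ℕ.* i ℕ.+ i) n)))
    (ℤ.*-zeroʳ (sgn (suc (i ℕ.* 2))))

  rearrange : ∀ s t x → 1ℤ * (s * t * x) ≡ t * (s * x)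
  rearrange = solve-∀

  even-terms : ∀ i → squareTerm f (n ℕ.* 4) (suc (i ℕ.* 2)) ≡ sgn n * squareTerm f n i
  even-terms i = begin
    sgn (j ℕ.* 2) * ((j ℕ.* 2 ℕ.* (j ℕ.* 2)) ▷ f) (n ℕ.* 4)
      ≡⟨ cong₂ (λ x k → x * (k ▷ f) (n ℕ.* 4)) (sgn-even j) (even-square j) ⟩
    1ℤ * ((j ℕ.* j ℕ.* 4) ▷ f) (n ℕ.* 4)
      ≡⟨ cong (1ℤ *_) (▷-residue 0 (j ℕ.* j) f n z<s) ⟩
    1ℤ * ((j ℕ.* j) ▷ (λ m → f (m ℕ.* 4))) n
      ≡⟨ cong (1ℤ *_) (▷-cong (j ℕ.* j) f₀ n) ⟩
    1ℤ * ((j ℕ.* j) ▷ (λ m → sgn m * f m)) n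
      ≡⟨ cong (1ℤ *_) (▷-sgn (j ℕ.* j) f n) ⟩
    1ℤ * (sgn (j ℕ.* j) * sgn n * ((j ℕ.* j) ▷ f) n)
      ≡⟨ cong (λ x → 1ℤ * (x * sgn n * ((j ℕ.* j) ▷ f) n)) (sgn-square j) ⟩
    1ℤ * (sgn j * sgn n * ((j ℕ.* j) ▷ f) n)
      ≡⟨ rearrange (sgn j) (sgn n) (((j ℕ.* j) ▷ f) n) ⟩
    sgn n * squareTerm f n i ∎
    where j = suc i

-- The congruence modulo 8

δ-signed : SignedAtMultiplesOf4 δ
δ-signed zero    = refl
δ-signed (suc m) = sym (ℤ.*-zeroʳ (sgn (suc m)))

Θδ-signed : SignedAtMultiplesOf4 (Θ δ)
Θδ-signed = Θ-signed δ (λ _ → refl) δ-signed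

ΘΘδ-signed : SignedAtMultiplesOf4 (Θ (Θ δ))
ΘΘδ-signed = Θ-signed (Θ δ) (Θ-vanishesAt-3 δ (λ _ → refl) (λ _ → refl)) Θδ-signed

theorem1p2 : (n : ℕ) → (+ p̄ n) ≡ (-1ℤ ^ n) * (+ p̄ (4 ℕ.* n)) [mod 8 ]
-- The cubic remainders enter with (-2)³ = -8, whence this quotient.
theorem1p2 n = ∣⇒∣ᵤ (divides (sgn n * R (n ℕ.* 4) - R n) (begin
  P n - sgn n * P (4 ℕ.* n)
    ≡⟨ cong (λ m → P n - sgn n * P m) (ℕ.*-comm 4 n) ⟩
  P n - sgn n * P (n ℕ.* 4)
    ≡⟨ cong₂ (λ x y → x - sgn n * y) (P-expansion n) (P-expansion (n ℕ.* 4)) ⟩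
  expand (δ n) (Θ δ n) (Θ (Θ δ) n) (R n) - sgn n * expand (δ (n ℕ.* 4)) (Θ δ (n ℕ.* 4)) (Θ (Θ δ) (n ℕ.* 4)) (R (n ℕ.* 4))
    ≡⟨ cong (λ x → expand (δ n) (Θ δ n) (Θ (Θ δ) n) (R n) - sgn n * x) signs ⟩
  expand (δ n) (Θ δ n) (Θ (Θ δ) n) (R n) - sgn n * expand (sgn n * δ n) (sgn n * Θ δ n) (sgn n * Θ (Θ δ) n) (R (n ℕ.* 4))
    -- All lower terms gather behind 1 - `sgn n * sgn n`, which is zero.
    ≡⟨ collect (sgn n) (δ n) (Θ δ n) (Θ (Θ δ) n) (R n) (R (n ℕ.* 4)) ⟩
  (1ℤ - sgn n * sgn n) * expand (δ n) (Θ δ n) (Θ (Θ δ) n) 0ℤ + (sgn n * R (n ℕ.* 4) - R n) * + 8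
    ≡⟨ cong (λ x → (1ℤ - x) * expand (δ n) (Θ δ n) (Θ (Θ δ) n) 0ℤ + (sgn n * R (n ℕ.* 4) - R n) * + 8) (sgn-sgn n) ⟩
  0ℤ * expand (δ n) (Θ δ n) (Θ (Θ δ) n) 0ℤ + (sgn n * R (n ℕ.* 4) - R n) * + 8
    ≡⟨ cong (_+ (sgn n * R (n ℕ.* 4) - R n) * + 8) (ℤ.*-zeroˡ (expand (δ n) (Θ δ n) (Θ (Θ δ) n) 0ℤ)) ⟩
  0ℤ + (sgn n * R (n ℕ.* 4) - R n) * + 8
    ≡⟨ ℤ.+-identityˡ _ ⟩
  (sgn n * R (n ℕ.* 4) - R n) * + 8 ∎))
  where
  open ≡-Reasoning
  R : ℕ → ℤ
  R = Θ (Θ (Θ P))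

  expand : ℤ → ℤ → ℤ → ℤ → ℤ
  expand x y z r = x + -2ℤ * (y + -2ℤ * (z + -2ℤ * r))

  signs : expand (δ (n ℕ.* 4)) (Θ δ (n ℕ.* 4)) (Θ (Θ δ) (n ℕ.* 4)) (R (n ℕ.* 4)) ≡
          expand (sgn n * δ n) (sgn n * Θ δ n) (sgn n * Θ (Θ δ) n) (R (n ℕ.* 4))
  signs = trans (cong₂ (λ x y → expand x y (Θ (Θ δ) (n ℕ.* 4)) (R (n ℕ.* 4))) (δ-signed n) (Θδ-signed n))
    (cong (λ z → expand (sgn n * δ n) (sgn n * Θ δ n) z (R (n ℕ.* 4))) (ΘΘδ-signed n))

  collect : ∀ s x y z r r′ →
    x + -2ℤ * (y + -2ℤ * (z + -2ℤ * r))
      - s * (s * x + -2ℤ * (s * y + -2ℤ * (s * z + -2ℤ * r′)))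
    ≡ (1ℤ - s * s) * (x + -2ℤ * (y + -2ℤ * (z + -2ℤ * 0ℤ))) + (s * r′ - r) * + 8
  collect = solve-∀
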